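{- Let $m\in\mathbb{N}$ be odd and divisible by $3$. Then the friendship graph $F_j$ is $\mathbb{Z}_m$-cordial for every integer $j$ with $\frac{2m}{3}\le j\le m$.
   Context: Graphs are finite, simple and undirected. For $n\in\mathbb{N}$, the friendship graph $F_n$ is the union of $n$ copies of the triangle $C_3$ joined at a single common (central) vertex. For an abelian group $A$ and a graph $G=(V,E)$, a vertex labeling $\ell:V\to A$ induces an edge labeling $\ell(\{v_1,v_2\})=\ell(v_1)+\ell(v_2)$. Let $f_V(a)=|\{v\in V:\ell(v)=a\}|$ and $f_E(a)=|\{e\in E:\ell(e)=a\}|$. The labeling is $A$-cordial if $|f_V(a_1)-f_V(a_2)|\le 1$ and $|f_E(a_1)-f_E(a_2)|\le 1$ for all $a_1,a_2\in A$; $G$ is $A$-cordial if it admits an $A$-cordial labeling. -}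

module Defs where

open import Algebra.Bundles using (AbelianGroup)
open import Algebra.Structures using (IsAbelianGroup)
open import Data.Fin.Base using (Fin; zero; suc; toℕ; combine)
import Data.Fin.Properties as Fin
open import Data.List.Base using (List; length; filter; allFin; cartesianProduct)
open import Data.Nat.Base using (ℕ; suc; _+_; _*_; _∸_; _≤_; _%_; ∣_-_∣; NonZero)
open import Data.Nat.DivMod
  using (_mod_; m%n<n; m<n⇒m%n≡m; %-distribˡ-+; m%n%n≡m%n; n%n≡0; m*n%n≡0)
import Data.Nat.Properties as ℕ
open import Data.Product.Base using (_×_; _,_; ∃-syntax)
open import Level using (Level; 0ℓ; _⊔_)
open import Relation.Binary.Core using (Rel)
open import Relation.Binary.Definitions using (Decidable; Symmetric)
open import Relation.Binary.PropositionalEquality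
open import Relation.Nullary using (¬_)
open import Relation.Nullary.Decidable using (¬?; _×-dec_)

private variable
  c ℓ : Level
  n : ℕ

record Graph (n : ℕ) : Set₁ where
  field
    Adj    : Rel (Fin n) 0ℓ
    adj?   : Decidable Adj
    symm   : Symmetric Adj
    irrefl : ∀ {v} → ¬ Adj v v

vertices : Graph n → List (Fin n)
vertices {n} _ = allFin n

-- The edge {u , v} is listed once, as the pair (u , v) with u < v.
edges : Graph n → List (Fin n × Fin n)
edges {n} G =
  filter (λ (u , v) → u Fin.<? v ×-dec Graph.adj? G u v)
         (cartesianProduct (allFin n) (allFin n))

-- Decidability of equality in A is what makes f_V and f_E computable.
module Cordiality (A : AbelianGroup c ℓ)
                  (_≟_ : Decidable (AbelianGroup._≈_ A)) where

  open AbelianGroup A using (Carrier; _∙_)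

  module _ (G : Graph n) (label : Fin n → Carrier) where

    fV : Carrier → ℕ
    fV a = length (filter (λ v → label v ≟ a) (vertices G))

    fE : Carrier → ℕ
    fE a = length (filter (λ (u , v) → (label u ∙ label v) ≟ a) (edges G))

    IsCordialLabeling : Set c
    IsCordialLabeling =
      (∀ a₁ a₂ → ∣ fV a₁ - fV a₂ ∣ ≤ 1) × (∀ a₁ a₂ → ∣ fE a₁ - fE a₂ ∣ ≤ 1)

  Cordial : Graph n → Set c
  Cordial {n} G = ∃[ label ] IsCordialLabeling G label

triangle : Graph 3
triangle = record
  { Adj    = _≢_
  ; adj?   = λ u v → ¬? (u Fin.≟ v)
  ; symm   = λ u≢v v≡u → u≢v (sym v≡u)
  ; irrefl = λ v≢v → v≢v refl
  }

-- The i-th triangle inside F_n.  Corner 0 of every triangle is the common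
-- centre 0; the two other corners are private to the i-th triangle.
corner : Fin n → Fin 3 → Fin (suc (n * 2))
corner i zero    = zero
corner i (suc b) = suc (combine i b)

corner-injective : (i : Fin n) (x y : Fin 3) → corner i x ≡ corner i y → x ≡ y
corner-injective i zero    zero    _  = refl
corner-injective i (suc x) (suc y) eq =
  cong suc (Fin.combine-injectiveʳ i x i y (Fin.suc-injective eq))

friendship : (n : ℕ) → Graph (suc (n * 2))
friendship n = record
  { Adj    = λ u v → ∃[ i ] ∃[ x ] ∃[ y ]
               (Graph.Adj triangle x y × u ≡ corner {n} i x × v ≡ corner i y)
  ; adj?   = λ u v → Fin.any? λ i → Fin.any? λ x → Fin.any? λ y →
               Graph.adj? triangle x y ×-dec
               (u Fin.≟ corner i x) ×-dec (v Fin.≟ corner i y)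
  ; symm   = λ (i , x , y , xy , u≡ , v≡) →
               i , y , x , Graph.symm triangle xy , v≡ , u≡
  ; irrefl = λ (i , x , y , xy , v≡x , v≡y) →
               xy (corner-injective i x y (trans (sym v≡x) v≡y))
  }

module _ (m : ℕ) .{{_ : NonZero m}} where

  _⊕_ : Fin m → Fin m → Fin m
  x ⊕ y = (toℕ x + toℕ y) mod m

  ⊖_ : Fin m → Fin m
  ⊖ x = (m ∸ toℕ x) mod m

  0# : Fin m
  0# = 0 mod m

  toℕ-mod : ∀ k → toℕ (k mod m) ≡ k % m
  toℕ-mod k = Fin.toℕ-fromℕ< (m%n<n k m)

  toℕ-% : (x : Fin m) → toℕ x % m ≡ toℕ x
  toℕ-% x = m<n⇒m%n≡m (Fin.toℕ<n x)

  mod-cong : ∀ {k l} → k % m ≡ l % m → k mod m ≡ l mod m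
  mod-cong {k} {l} eq =
    Fin.toℕ-injective (trans (toℕ-mod k) (trans eq (sym (toℕ-mod l))))

  mod-toℕ : (x : Fin m) → toℕ x mod m ≡ x
  mod-toℕ x = Fin.toℕ-injective (trans (toℕ-mod (toℕ x)) (toℕ-% x))

  %-absorbˡ : ∀ k l → (k % m + l) % m ≡ (k + l) % m
  %-absorbˡ k l = begin
    (k % m + l) % m          ≡⟨ %-distribˡ-+ (k % m) l m ⟩
    (k % m % m + l % m) % m  ≡⟨ cong (λ z → (z + l % m) % m) (m%n%n≡m%n k m) ⟩
    (k % m + l % m) % m      ≡⟨ %-distribˡ-+ k l m ⟨
    (k + l) % m              ∎
    where open ≡-Reasoning

  ⊕-modˡ : ∀ k (y : Fin m) → (k mod m) ⊕ y ≡ (k + toℕ y) mod m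
  ⊕-modˡ k y = trans (cong (λ z → (z + toℕ y) mod m) (toℕ-mod k))
                     (mod-cong (%-absorbˡ k (toℕ y)))

  ⊕-comm : ∀ x y → x ⊕ y ≡ y ⊕ x
  ⊕-comm x y = cong (_mod m) (ℕ.+-comm (toℕ x) (toℕ y))

  ⊕-assoc : ∀ x y z → (x ⊕ y) ⊕ z ≡ x ⊕ (y ⊕ z)
  ⊕-assoc x y z = begin
    (x ⊕ y) ⊕ z                        ≡⟨ ⊕-modˡ (toℕ x + toℕ y) z ⟩
    (toℕ x + toℕ y + toℕ z) mod m      ≡⟨ cong (_mod m) (ℕ.+-assoc (toℕ x) (toℕ y) (toℕ z)) ⟩
    (toℕ x + (toℕ y + toℕ z)) mod m    ≡⟨ cong (_mod m) (ℕ.+-comm (toℕ x) (toℕ y + toℕ z)) ⟩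
    (toℕ y + toℕ z + toℕ x) mod m      ≡⟨ ⊕-modˡ (toℕ y + toℕ z) x ⟨
    (y ⊕ z) ⊕ x                        ≡⟨ ⊕-comm (y ⊕ z) x ⟩
    x ⊕ (y ⊕ z)                        ∎
    where open ≡-Reasoning

  ⊕-identityˡ : ∀ x → 0# ⊕ x ≡ x
  ⊕-identityˡ x = trans (⊕-modˡ 0 x) (mod-toℕ x)

  ⊕-inverseˡ : ∀ x → (⊖ x) ⊕ x ≡ 0#
  ⊕-inverseˡ x = begin
    (⊖ x) ⊕ x                  ≡⟨ ⊕-modˡ (m ∸ toℕ x) x ⟩
    (m ∸ toℕ x + toℕ x) mod m  ≡⟨ cong (_mod m) (ℕ.m∸n+n≡m (ℕ.<⇒≤ (Fin.toℕ<n x))) ⟩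
    m mod m                    ≡⟨ mod-cong (trans (n%n≡0 m) (sym (m*n%n≡0 0 m))) ⟩
    0#                         ∎
    where open ≡-Reasoning

  isAbelianGroup : IsAbelianGroup _≡_ _⊕_ 0# ⊖_
  isAbelianGroup = record
    { isGroup = record
      { isMonoid = record
        { isSemigroup = record
          { isMagma = record
            { isEquivalence = isEquivalence
            ; ∙-cong        = cong₂ _⊕_
            }
          ; assoc = ⊕-assoc
          }
        ; identity = ⊕-identityˡ , λ x → trans (⊕-comm x 0#) (⊕-identityˡ x)
        }
      ; inverse = ⊕-inverseˡ , λ x → trans (⊕-comm x (⊖ x)) (⊕-inverseˡ x)
      ; ⁻¹-cong = cong ⊖_
      }
    ; comm = ⊕-comm
    }

  ℤmod : AbelianGroup 0ℓ 0ℓ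
  ℤmod = record { isAbelianGroup = isAbelianGroup }

  ℤmod-Cordial : Graph n → Set
  ℤmod-Cordial = Cordiality.Cordial ℤmod Fin._≟_

{-# OPTIONS --safe #-}
module Submission where

open import Defs
open import Data.Nat using (ℕ; _*_; _/_; _≤_; NonZero)
open import Data.Nat.Divisibility using (_∣_)
open import Relation.Nullary using (¬_)

open import Data.Bool.Base using (if_then_else_)
open import Data.Empty using (⊥-elim)
open import Data.Fin.Base as Fin using (Fin; zero; suc; toℕ; combine; remQuot)
import Data.Fin.Properties as Fin
open import Data.List.Base
  using (List; []; _∷_; _++_; map; length; lookup; filter; allFin; cartesianProduct; cartesianProductWith)
open import Data.List.Membership.Propositional using (_∈_)
open import Data.List.Membership.Propositional.Properties
  using (∈-allFin; ∈-filter⁺; ∈-filter⁻; ∈-cartesianProduct⁺;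
         ∈-cartesianProductWith⁺; ∈-cartesianProductWith⁻)
open import Data.List.Membership.Propositional.Properties.WithK using (unique∧set⇒bag)
open import Data.List.Properties using (length-++; map-++; map-cong; map-tabulate; map-∘; tabulate-lookup)
open import Data.List.Relation.Binary.BagAndSetEquality using (∼bag⇒↭)
open import Data.List.Relation.Binary.Permutation.Propositional using (_↭_)
open import Data.List.Relation.Binary.Permutation.Propositional.Properties using (map⁺)
import Data.List.Relation.Unary.All as All
open import Data.List.Relation.Unary.AllPairs using (_∷_)
open import Data.List.Relation.Unary.Any using (here; there)
open import Data.List.Relation.Unary.Unique.Propositional using (Unique)
import Data.List.Relation.Unary.Unique.Propositional.Properties as Unique
open import Data.Nat.Base using (zero; suc; _+_; _∸_; _<_; _%_; ∣_-_∣; z≤n; s≤s; z<s; s<s)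
open import Data.Nat.DivMod using (_mod_; [m+n]%n≡m%n; m<n⇒m%n≡m; m*n/n≡m)
open import Data.Nat.Divisibility using (divides)
open import Data.Nat.ListAction using (sum)
open import Data.Nat.ListAction.Properties using (sum-++; sum-↭)
open import Data.Nat.Properties as ℕ using (+-assoc; +-comm; +-identityʳ; +-suc)
open import Data.Nat.Tactic.RingSolver using (solve-∀)
open import Data.Product using (_×_; _,_; proj₁; proj₂; ∃-syntax)
open import Data.Sum using (_⊎_; inj₁; inj₂)
open import Function.Base using (_∘_; id)
open import Function.Bundles using (mk⇔)
open import Relation.Binary.PropositionalEquality
open import Relation.Nullary using (Dec; yes; no; does)
open import Relation.Nullary.Decidable using (_×-dec_)
open import Relation.Unary using (Pred; Decidable)

-- Label the centre 0 and let m = 3k.  With b running through k consecutive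
-- multiples of 3, the triangles of full b, carrying the outer labels
--   (b + 3, b + 3), (b + 2, b + 5), (b + 4, b + 1),
-- use every vertex label twice and, doubling being a bijection modulo the odd
-- number k, every edge label three times.  This settles j = m.  Replacing the
-- three triangles by (b + 3, b + 4), (b + 3, b + 2) (reduced b) removes the
-- vertex labels b + 5, b + 1 and the edge labels b + 5, b + 1, 2b + 6; as b
-- varies no label is removed twice, so t = m - j blocks may be reduced.
-- The label 0, carried by the centre as well, must be lost once more among the
-- vertices; for this the block with b + 3 ≡ 0 is treated separately: its pairs
-- (0, 0), (-1, 2), (1, -2) become (1, -1), (1, -1) if t ≥ 3 (core), both
-- neighbouring blocks being reduced as well, and (1, -1), (2, -2) if t ≤ 2
-- (core₁).  For t = 2 the pair (2, 5) of the next block is deleted in addition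
-- (shortened).

-- Counting by sums over lists.

indicator : ∀ {p} {P : Set p} → Dec P → ℕ
indicator P? = if does P? then 1 else 0

length-filter : ∀ {a p} {A : Set a} {P : Pred A p} (P? : Decidable P) xs →
  length (filter P? xs) ≡ sum (map (λ x → indicator (P? x)) xs)
length-filter P? []       = refl
length-filter P? (x ∷ xs) with P? x
... | yes _ = cong suc (length-filter P? xs)
... | no  _ = length-filter P? xs

-- Without repetitions every multiplicity is 0 or 1, so equal membership suffices. This replaces the
-- filtered lists `vertices` and `edges` by listings along the triangles.
unique∧set⇒↭ : ∀ {a} {A : Set a} {xs ys : List A} → Unique xs → Unique ys →
  (∀ {x} → x ∈ xs → x ∈ ys) → (∀ {x} → x ∈ ys → x ∈ xs) → xs ↭ ys
unique∧set⇒↭ xs! ys! xs⊆ys ys⊆xs = ∼bag⇒↭ (unique∧set⇒bag xs! ys! (mk⇔ xs⊆ys ys⊆xs))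

sum-map-cartesianProductWith : ∀ {a b c} {A : Set a} {B : Set b} {C : Set c}
  (h : C → ℕ) (f : A → B → C) xs ys →
  sum (map h (cartesianProductWith f xs ys)) ≡ sum (map (λ x → sum (map (h ∘ f x) ys)) xs)
sum-map-cartesianProductWith h f []       ys = refl
sum-map-cartesianProductWith h f (x ∷ xs) ys
  rewrite map-++ h (map (f x) ys) (cartesianProductWith f xs ys)
        | sum-++ (map h (map (f x) ys)) (map h (cartesianProductWith f xs ys))
        | map-∘ {g = h} {f = f x} ys
        = cong (_ +_) (sum-map-cartesianProductWith h f xs ys)

map-lookup-allFin : ∀ {a b} {A : Set a} {B : Set b} (w : A → B) (xs : List A) →
  map (w ∘ lookup xs) (allFin (length xs)) ≡ map w xs
map-lookup-allFin w xs =
  trans (map-∘ (allFin (length xs)))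
        (cong (map w) (trans (map-tabulate id (lookup xs)) (tabulate-lookup xs)))

-- Vertices and edges of the friendship graph, triangle by triangle.

module _ (n : ℕ) where

  outer : Fin n → Fin 2 → Fin (suc (n * 2))
  outer i b = suc (combine i b)

  friendshipVertices : List (Fin (suc (n * 2)))
  friendshipVertices = zero ∷ cartesianProductWith outer (allFin n) (allFin 2)

  -- Each pair has its smaller vertex first, the orientation that `edges` selects.
  triangleEdge : Fin n → Fin 3 → Fin (suc (n * 2)) × Fin (suc (n * 2))
  triangleEdge i zero             = zero , outer i zero
  triangleEdge i (suc zero)       = zero , outer i (suc zero)
  triangleEdge i (suc (suc zero)) = outer i zero , outer i (suc zero)

  friendshipEdges : List (Fin (suc (n * 2)) × Fin (suc (n * 2)))
  friendshipEdges = cartesianProductWith triangleEdge (allFin n) (allFin 3)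

  outer-injective : ∀ {i i′ b b′} → outer i b ≡ outer i′ b′ → i ≡ i′ × b ≡ b′
  outer-injective eq = Fin.combine-injective _ _ _ _ (Fin.suc-injective eq)

  triangleEdge-injective : ∀ {i i′ c c′} → triangleEdge i c ≡ triangleEdge i′ c′ → i ≡ i′ × c ≡ c′
  triangleEdge-injective {c = zero} {zero} eq = proj₁ (outer-injective (cong proj₂ eq)) , refl
  triangleEdge-injective {c = zero} {suc zero} eq with () ← proj₂ (outer-injective (cong proj₂ eq))
  triangleEdge-injective {c = zero} {suc (suc zero)} ()
  triangleEdge-injective {c = suc zero} {zero} eq with () ← proj₂ (outer-injective (cong proj₂ eq))
  triangleEdge-injective {c = suc zero} {suc zero} eq = proj₁ (outer-injective (cong proj₂ eq)) , refl
  triangleEdge-injective {c = suc zero} {suc (suc zero)} ()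
  triangleEdge-injective {c = suc (suc zero)} {zero} ()
  triangleEdge-injective {c = suc (suc zero)} {suc zero} ()
  triangleEdge-injective {c = suc (suc zero)} {suc (suc zero)} eq = proj₁ (outer-injective (cong proj₁ eq)) , refl

  vertices-↭ : vertices (friendship n) ↭ friendshipVertices
  vertices-↭ = unique∧set⇒↭ (Unique.allFin⁺ _)
    (All.tabulate centre∉ ∷
      Unique.cartesianProductWith⁺ outer outer-injective (Unique.allFin⁺ n) (Unique.allFin⁺ 2))
    (λ {v} _ → complete v) (λ _ → ∈-allFin _)
    where
    centre∉ : ∀ {v} → v ∈ cartesianProductWith outer (allFin n) (allFin 2) → zero ≢ v
    centre∉ v∈ refl with ∈-cartesianProductWith⁻ outer (allFin n) (allFin 2) v∈
    ... | _ , _ , _ , _ , ()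
    complete : ∀ v → v ∈ friendshipVertices
    complete zero = here refl
    complete (suc v) with i , b , refl ← Fin.combine-surjective {n} {2} v =
      there (∈-cartesianProductWith⁺ outer (∈-allFin i) (∈-allFin b))

  combine-mono : (i : Fin n) {b b′ : Fin 2} → b Fin.< b′ → outer i b Fin.< outer i b′
  combine-mono i {b} {b′} b<b′ rewrite Fin.toℕ-combine i b | Fin.toℕ-combine i b′ =
    s<s (ℕ.+-monoʳ-< (2 * toℕ i) b<b′)

  edges-↭ : edges (friendship n) ↭ friendshipEdges
  edges-↭ = unique∧set⇒↭
    (Unique.filter⁺ edge? (Unique.cartesianProduct⁺ (Unique.allFin⁺ _) (Unique.allFin⁺ _)))
    (Unique.cartesianProductWith⁺ triangleEdge triangleEdge-injective (Unique.allFin⁺ n) (Unique.allFin⁺ 3))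
    (λ e∈ → complete _ _ (proj₂ (∈-filter⁻ edge? {xs = pairs} e∈)))
    sound
    where
    N = suc (n * 2)
    pairs = cartesianProduct (allFin N) (allFin N)
    edge? = λ ((u , v) : Fin N × Fin N) → u Fin.<? v ×-dec Graph.adj? (friendship n) u v

    listed : ∀ i c → triangleEdge i c ∈ friendshipEdges
    listed i c = ∈-cartesianProductWith⁺ triangleEdge (∈-allFin i) (∈-allFin c)

    complete : ∀ u v → u Fin.< v × Graph.Adj (friendship n) u v → (u , v) ∈ friendshipEdges
    complete u v (u<v , i , zero , zero , x≢y , _) = ⊥-elim (x≢y refl)
    complete u v (u<v , i , zero , suc zero , x≢y , refl , refl) = listed i zero
    complete u v (u<v , i , zero , suc (suc zero) , x≢y , refl , refl) = listed i (suc zero)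
    -- The centre is vertex 0 and cannot be the larger end.
    complete u v (() , i , suc x , zero , x≢y , refl , refl)
    complete u v (u<v , i , suc zero , suc zero , x≢y , _) = ⊥-elim (x≢y refl)
    complete u v (u<v , i , suc zero , suc (suc zero) , x≢y , refl , refl) = listed i (suc (suc zero))
    complete u v (u<v , i , suc (suc zero) , suc zero , x≢y , refl , refl) =
      ⊥-elim (ℕ.<-asym u<v (combine-mono i {zero} {suc zero} z<s))
    complete u v (u<v , i , suc (suc zero) , suc (suc zero) , x≢y , _) = ⊥-elim (x≢y refl)

    isEdge : ∀ i c → let (u , v) = triangleEdge i c in u Fin.< v × Graph.Adj (friendship n) u v
    isEdge i zero             = z<s , i , zero , suc zero , (λ ()) , refl , refl
    isEdge i (suc zero)       = z<s , i , zero , suc (suc zero) , (λ ()) , refl , refl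
    isEdge i (suc (suc zero)) =
      combine-mono i {zero} {suc zero} z<s , i , suc zero , suc (suc zero) , (λ ()) , refl , refl

    sound : ∀ {e} → e ∈ friendshipEdges → e ∈ filter edge? pairs
    sound e∈ with i , c , _ , _ , refl ← ∈-cartesianProductWith⁻ triangleEdge (allFin n) (allFin 3) e∈ =
      ∈-filter⁺ edge? (∈-cartesianProduct⁺ (∈-allFin _) (∈-allFin _)) (isEdge i c)

-- Labellings given by lists of pairs.

-- A triangle is encoded by the labels of its two outer vertices; its centre
-- has label 0 and is not counted in vertexWeight.
vertexWeight edgeWeight : (ℕ → ℕ) → ℕ × ℕ → ℕ
vertexWeight f (p , q) = f p + f q
edgeWeight   f (p , q) = f p + f q + f (p + q)

total : ∀ {a} {A : Set a} → (A → ℕ) → List A → ℕ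
total w xs = sum (map w xs)

module _ (m : ℕ) .{{_ : NonZero m}} where

  hits : Fin m → ℕ → ℕ
  hits a n = indicator (n mod m Fin.≟ a)

  mod-⊕ : ∀ p q → _⊕_ m (p mod m) (q mod m) ≡ (p + q) mod m
  mod-⊕ p q = trans (⊕-modˡ m p (q mod m)) (mod-cong m (trans
    (cong (λ z → (p + z) % m) (toℕ-mod m q))
    (trans (cong (_% m) (ℕ.+-comm p (q % m))) (trans (%-absorbˡ m q p) (cong (_% m) (ℕ.+-comm q p))))))

  module _ (L : List (ℕ × ℕ)) where

    private
      j = length L
      open Cordiality (ℤmod m) Fin._≟_

      component : ℕ × ℕ → Fin 2 → ℕ
      component (p , q) zero       = p
      component (p , q) (suc zero) = q

      -- Labels stay natural numbers until `labelling` reduces them, so that blocks can be written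
      -- and added in ℕ.
      numeral : Fin (suc (j * 2)) → ℕ
      numeral zero    = 0
      numeral (suc v) = let (i , b) = remQuot {j} 2 v in component (lookup L i) b

      numeral-outer : ∀ i b → numeral (outer j i b) ≡ component (lookup L i) b
      numeral-outer i b = cong (λ (i′ , b′) → component (lookup L i′) b′) (Fin.remQuot-combine {j} i b)

    labelling : Fin (suc (j * 2)) → Fin m
    labelling v = numeral v mod m

    total-over-triangles : (w : ℕ × ℕ → ℕ) {g : Fin j → ℕ} → (∀ i → g i ≡ w (lookup L i)) →
      sum (map g (allFin j)) ≡ total w L
    total-over-triangles w g≗ = cong sum (trans (map-cong g≗ (allFin j)) (map-lookup-allFin w L))

    fV-labelling : ∀ a → fV (friendship j) labelling a ≡ hits a 0 + total (vertexWeight (hits a)) L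
    fV-labelling a = begin
      fV (friendship j) labelling a
        ≡⟨ length-filter _ (vertices (friendship j)) ⟩
      sum (map h (vertices (friendship j)))
        ≡⟨ sum-↭ (map⁺ h (vertices-↭ j)) ⟩
      sum (map h (friendshipVertices j))
        ≡⟨ cong (h zero +_) (sum-map-cartesianProductWith h (outer j) (allFin j) (allFin 2)) ⟩
      hits a 0 + sum (map _ (allFin j))
        ≡⟨ cong (hits a 0 +_) (total-over-triangles (vertexWeight (hits a)) pointwise) ⟩
      hits a 0 + total (vertexWeight (hits a)) L ∎
      where
      open ≡-Reasoning
      h = λ v → indicator (labelling v Fin.≟ a)
      pointwise : ∀ i → h (outer j i zero) + (h (outer j i (suc zero)) + 0)
        ≡ vertexWeight (hits a) (lookup L i)
      pointwise i rewrite numeral-outer i zero | numeral-outer i (suc zero)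
        with lookup L i
      ... | p , q = cong (hits a p +_) (ℕ.+-identityʳ _)

    fE-labelling : ∀ a → fE (friendship j) labelling a ≡ total (edgeWeight (hits a)) L
    fE-labelling a = begin
      fE (friendship j) labelling a
        ≡⟨ length-filter _ (edges (friendship j)) ⟩
      sum (map h (edges (friendship j)))
        ≡⟨ sum-↭ (map⁺ h (edges-↭ j)) ⟩
      sum (map h (friendshipEdges j))
        ≡⟨ sum-map-cartesianProductWith h (triangleEdge j) (allFin j) (allFin 3) ⟩
      sum (map _ (allFin j))
        ≡⟨ total-over-triangles (edgeWeight (hits a)) pointwise ⟩
      total (edgeWeight (hits a)) L ∎
      where
      open ≡-Reasoning
      h : Fin (suc (j * 2)) × Fin (suc (j * 2)) → ℕ
      h (u , v) = indicator (_⊕_ m (labelling u) (labelling v) Fin.≟ a)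
      h≡ : ∀ u v → h (u , v) ≡ hits a (numeral u + numeral v)
      h≡ u v = cong (λ x → indicator (x Fin.≟ a)) (mod-⊕ (numeral u) (numeral v))
      pointwise : ∀ i → h (triangleEdge j i zero) + (h (triangleEdge j i (suc zero))
        + (h (triangleEdge j i (suc (suc zero))) + 0))
        ≡ edgeWeight (hits a) (lookup L i)
      pointwise i rewrite h≡ zero (outer j i zero) | h≡ zero (outer j i (suc zero))
        | h≡ (outer j i zero) (outer j i (suc zero))
        | numeral-outer i zero | numeral-outer i (suc zero)
        with lookup L i
      ... | p , q = trans (cong (λ z → hits a p + (hits a q + z)) (+-identityʳ _))
        (sym (ℕ.+-assoc (hits a p) (hits a q) _))

-- Sums along arithmetic progressions.

∑ : ℕ → (ℕ → ℕ) → ℕ → ℕ → ℕ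
∑ d f c zero    = 0
-- With the step on the left, `3 + (3 + c)` computes to `6 + c`, so leading terms of a sum over
-- blocks unfold by themselves.
∑ d f c (suc n) = f c + ∑ d f (d + c) n

∑-cong : ∀ {d f g} → (∀ x → f x ≡ g x) → ∀ c n → ∑ d f c n ≡ ∑ d g c n
∑-cong f≗g c zero    = refl
∑-cong f≗g c (suc n) = cong₂ _+_ (f≗g c) (∑-cong f≗g _ n)

∑-distrib-+ : ∀ {d} f g c n → ∑ d (λ x → f x + g x) c n ≡ ∑ d f c n + ∑ d g c n
∑-distrib-+ f g c zero = refl
∑-distrib-+ {d} f g c (suc n) rewrite ∑-distrib-+ {d} f g (d + c) n =
  interchange (f c) (g c) (∑ d f (d + c) n) (∑ d g (d + c) n)
  where
  interchange : ∀ w x y z → w + x + (y + z) ≡ w + y + (x + z)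
  interchange = solve-∀

∑-split : ∀ d f c n l → ∑ d f c (n + l) ≡ ∑ d f c n + ∑ d f (n * d + c) l
∑-split d f c zero    l = refl
∑-split d f c (suc n) l = begin
  f c + ∑ d f (d + c) (n + l)
    ≡⟨ cong (f c +_) (∑-split d f (d + c) n l) ⟩
  f c + (∑ d f (d + c) n + ∑ d f (n * d + (d + c)) l)
    ≡⟨ cong (λ z → f c + (∑ d f (d + c) n + ∑ d f z l)) (eq d n c) ⟩
  f c + (∑ d f (d + c) n + ∑ d f (d + n * d + c) l)
    ≡⟨ +-assoc (f c) _ _ ⟨
  f c + ∑ d f (d + c) n + ∑ d f (d + n * d + c) l          ∎
  where
  open ≡-Reasoning
  eq : ∀ d n c → n * d + (d + c) ≡ d + n * d + c
  eq = solve-∀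

∑-prefix : ∀ d f c n l → ∑ d f c n ≤ ∑ d f c (n + l)
∑-prefix d f c n l = ℕ.≤-trans (ℕ.m≤m+n _ _) (ℕ.≤-reflexive (sym (∑-split d f c n l)))

-- After adding `f c`, both sides are the sum of `1 + n` terms from `c`: on the left `f c` is its
-- first term, on the right it equals the last one by periodicity.
∑-rotate : ∀ d f c n → f (n * d + c) ≡ f c → ∑ d f (d + c) n ≡ ∑ d f c n
∑-rotate d f c n per = ℕ.+-cancelˡ-≡ (f c) _ _ (begin
  ∑ d f c (1 + n)                  ≡⟨ cong (∑ d f c) (+-comm 1 n) ⟩
  ∑ d f c (n + 1)                  ≡⟨ ∑-split d f c n 1 ⟩
  ∑ d f c n + (f (n * d + c) + 0)  ≡⟨ cong (∑ d f c n +_) (trans (+-identityʳ _) per) ⟩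
  ∑ d f c n + f c                  ≡⟨ +-comm _ (f c) ⟩
  f c + ∑ d f c n                  ∎)
  where open ≡-Reasoning

∑-interleave : ∀ d f c n → ∑ d f c (n + n) ≡ ∑ (d + d) f c n + ∑ (d + d) f (d + c) n
∑-interleave d f c zero    = refl
∑-interleave d f c (suc n) = begin
  f c + ∑ d f (d + c) (n + suc n)
    ≡⟨ cong (λ z → f c + ∑ d f (d + c) z) (+-suc n n) ⟩
  f c + (f (d + c) + ∑ d f (d + (d + c)) (n + n))
    ≡⟨ cong (λ z → f c + (f (d + c) + z)) (∑-interleave d f (d + (d + c)) n) ⟩
  f c + (f (d + c) + (∑ (d + d) f (d + (d + c)) n + ∑ (d + d) f (d + (d + (d + c))) n))
    ≡⟨ cong₂ (λ y z → f c + (f (d + c) + (∑ (d + d) f y n + ∑ (d + d) f z n)))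
         (+-assoc d d c) (+-assoc d d (d + c)) ⟨
  f c + (f (d + c) + (∑ (d + d) f (d + d + c) n + ∑ (d + d) f (d + d + (d + c)) n))
    ≡⟨ regroup (f c) (f (d + c)) _ _ ⟩
  f c + ∑ (d + d) f (d + d + c) n + (f (d + c) + ∑ (d + d) f (d + d + (d + c)) n) ∎
  where
  open ≡-Reasoning
  regroup : ∀ w x y z → w + (x + (y + z)) ≡ w + y + (x + z)
  regroup = solve-∀

-- Doubling permutes the residues modulo an odd number.
∑-double : ∀ d f c h → (∀ x → f (suc (h + h) * d + x) ≡ f x) →
  ∑ (d + d) f c (suc (h + h)) ≡ ∑ d f c (suc (h + h))
∑-double d f c h per = begin
  ∑ (d + d) f c (suc h + h)
    ≡⟨ ∑-split (d + d) f c (suc h) h ⟩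
  ∑ (d + d) f c (suc h) + ∑ (d + d) f (suc h * (d + d) + c) h
    -- Since (h + 1)2d = (2h + 1)d + d, the last h terms wrap around to start at d + c: they fill
    -- the odd positions, the first h + 1 terms the even ones.
    ≡⟨ cong (∑ (d + d) f c (suc h) +_) (shift (d + c) h) ⟩
  f c + ∑ (d + d) f (d + d + c) h + ∑ (d + d) f (d + c) h
    ≡⟨ lemma (f c) _ _ ⟩
  f c + (∑ (d + d) f (d + c) h + ∑ (d + d) f (d + d + c) h)
    ≡⟨ cong (λ z → f c + (∑ (d + d) f (d + c) h + ∑ (d + d) f z h)) (+-assoc d d c) ⟩
  f c + (∑ (d + d) f (d + c) h + ∑ (d + d) f (d + (d + c)) h)
    ≡⟨ cong (f c +_) (∑-interleave d f (d + c) h) ⟨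
  f c + ∑ d f (d + c) (h + h) ∎
  where
  open ≡-Reasoning
  lemma : ∀ x y z → x + y + z ≡ x + (z + y)
  lemma = solve-∀
  eq : ∀ d h c → suc h * (d + d) + c ≡ suc (h + h) * d + (d + c)
  eq = solve-∀
  assoc′ : ∀ x d p → (d + d) + (p + x) ≡ p + ((d + d) + x)
  assoc′ = solve-∀
  translate : ∀ x n → ∑ (d + d) f (suc (h + h) * d + x) n ≡ ∑ (d + d) f x n
  translate x zero    = refl
  translate x (suc n) = cong₂ _+_ (per x)
    (trans (cong (λ z → ∑ (d + d) f z n) (assoc′ x d (suc (h + h) * d))) (translate (d + d + x) n))
  shift : ∀ x n → ∑ (d + d) f (suc h * (d + d) + c) n ≡ ∑ (d + d) f (d + c) n
  shift x n = trans (cong (λ z → ∑ (d + d) f z n) (eq d h c)) (translate (d + c) n)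

∑-0 : ∀ d c n → ∑ d (λ _ → 0) c n ≡ 0
∑-0 d c zero    = refl
∑-0 d c (suc n) = ∑-0 d (d + c) n

∑-offset : ∀ d f r c n → ∑ d (λ x → f (r + x)) c n ≡ ∑ d f (r + c) n
∑-offset d f r c zero    = refl
∑-offset d f r c (suc n) = cong (f (r + c) +_)
  (trans (∑-offset d f r (d + c) n) (cong (λ z → ∑ d f z n) (swap r d c)))
  where
  swap : ∀ r d c → r + (d + c) ≡ d + (r + c)
  swap = solve-∀

∑-triples : ∀ f c n → ∑ 3 (λ x → f x + f (1 + x) + f (2 + x)) c n ≡ ∑ 1 f c (n * 3)
∑-triples f c zero    = refl
∑-triples f c (suc n) rewrite ∑-triples f (3 + c) n = lemma (f c) _ _ _
  where
  lemma : ∀ x y z w → x + y + z + w ≡ x + (y + (z + w))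
  lemma = solve-∀

-- f counts the members of one residue class modulo k * 3.
record ResidueCount (k : ℕ) (f : ℕ → ℕ) : Set where
  field
    periodic : ∀ x → f (k * 3 + x) ≡ f x
    unit     : ∑ 1 f 0 (k * 3) ≡ 1

  -- Moving the window by one drops `f c` and gains the equal term one period later.
  unit-from : ∀ c → ∑ 1 f c (k * 3) ≡ 1
  unit-from zero    = unit
  unit-from (suc c) = trans
    (∑-rotate 1 f c (k * 3) (trans (cong (λ z → f (z + c)) (ℕ.*-identityʳ (k * 3))) (periodic c)))
    (unit-from c)

-- Blocks of triangles.

full reduced core : ℕ → List (ℕ × ℕ)
-- The middle label is `3 + b` rather than `b`, so that its neighbours at distance 1 and 2 need no
-- subtraction.
full    b = (3 + b , 3 + b) ∷ (2 + b , 5 + b) ∷ (4 + b , 1 + b) ∷ []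
reduced b = (3 + b , 4 + b) ∷ (3 + b , 2 + b) ∷ []
core    b = (4 + b , 2 + b) ∷ (4 + b , 2 + b) ∷ []

blocks : (ℕ → List (ℕ × ℕ)) → ℕ → ℕ → List (ℕ × ℕ)
blocks B b zero    = []
blocks B b (suc n) = B b ++ blocks B (3 + b) n

total-++ : ∀ {a} {A : Set a} (w : A → ℕ) xs ys → total w (xs ++ ys) ≡ total w xs + total w ys
total-++ w xs ys = trans (cong sum (map-++ w xs ys)) (sum-++ (map w xs) (map w ys))

total-blocks : ∀ w B b n → total w (blocks B b n) ≡ ∑ 3 (λ x → total w (B x)) b n
total-blocks w B b zero    = refl
total-blocks w B b (suc n) = trans (total-++ w (B b) _) (cong (total w (B b) +_) (total-blocks w B (3 + b) n))

-- What reduced b lacks compared with full b: the vertex labels b + 5, b + 1,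
-- and, as edge labels, these two and 2b + 6.
lostVertices lostEdges : (ℕ → ℕ) → ℕ → ℕ
lostVertices f b = f (5 + b) + f (1 + b)
lostEdges    f b = f (3 + b + (3 + b)) + lostVertices f b

total-++-blocks : ∀ w xs B b n → total w (xs ++ blocks B b n)
  ≡ total w xs + ∑ 3 (λ x → total w (B x)) b n
total-++-blocks w xs B b n = trans (total-++ w xs (blocks B b n))
  (cong (total w xs +_) (total-blocks w B b n))

-- Counts by classes modulo 3.

module Classes {k f} (h : ℕ) (k-odd : k ≡ suc (h + h)) (F : ResidueCount k f) (q : ℕ) where
  open ResidueCount F

  -- As 3 divides the modulus, this is 1 if the residue counted by `f` is congruent to `r` modulo 3,
  -- and 0 otherwise.
  class : ℕ → ℕ
  class r = ∑ 3 (λ x → f (r + x)) (q * 3) k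

  class-3+ : ∀ r → class (3 + r) ≡ class r
  class-3+ r = begin
    class (3 + r)             ≡⟨ ∑-offset 3 f (3 + r) (q * 3) k ⟩
    ∑ 3 f (3 + r + q * 3) k   ≡⟨ ∑-rotate 3 f (r + q * 3) k (periodic _) ⟩
    ∑ 3 f (r + q * 3) k       ≡⟨ ∑-offset 3 f r (q * 3) k ⟨
    class r                   ∎
    where open ≡-Reasoning

  class-*3+ : ∀ p r → class (p * 3 + r) ≡ class r
  class-*3+ zero    r = refl
  class-*3+ (suc p) r = trans (class-3+ (p * 3 + r)) (class-*3+ p r)

  class-partition : class 0 + class 1 + class 2 ≡ 1
  class-partition = begin
    class 0 + class 1 + class 2
      ≡⟨ cong (_+ class 2) (∑-distrib-+ f (λ x → f (1 + x)) (q * 3) k) ⟨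
    ∑ 3 (λ x → f x + f (1 + x)) (q * 3) k + class 2
      ≡⟨ ∑-distrib-+ (λ x → f x + f (1 + x)) (λ x → f (2 + x)) (q * 3) k ⟨
    ∑ 3 (λ x → f x + f (1 + x) + f (2 + x)) (q * 3) k
      ≡⟨ ∑-triples f (q * 3) k ⟩
    ∑ 1 f (q * 3) (k * 3)
      ≡⟨ unit-from (q * 3) ⟩
    1 ∎
    where open ≡-Reasoning

  -- The arguments advance in steps of 6, which modulo `k * 3` with `k` odd reach the same residues
  -- as steps of 3. The starting point then matters only modulo 3.
  class-double : ∀ r s → ∑ 3 (λ x → f (r + x + (s + x))) (q * 3) k ≡ class (r + s)
  class-double r s = begin
    ∑ 3 (λ x → f (r + x + (s + x))) (q * 3) k  ≡⟨ spread (q * 3) k ⟩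
    ∑ 6 f (r + q * 3 + (s + q * 3)) k          ≡⟨ double ⟩
    ∑ 3 f (r + q * 3 + (s + q * 3)) k          ≡⟨ cong (λ z → ∑ 3 f z k) (eq r s q) ⟩
    ∑ 3 f (q * 3 + (r + s) + q * 3) k          ≡⟨ ∑-offset 3 f (q * 3 + (r + s)) (q * 3) k ⟨
    class (q * 3 + (r + s))                    ≡⟨ class-*3+ q (r + s) ⟩
    class (r + s)                              ∎
    where
    open ≡-Reasoning
    eq : ∀ r s q → r + q * 3 + (s + q * 3) ≡ q * 3 + (r + s) + q * 3
    eq = solve-∀
    eq′ : ∀ r s c → r + (3 + c) + (s + (3 + c)) ≡ 6 + (r + c + (s + c))
    eq′ = solve-∀
    spread : ∀ c n → ∑ 3 (λ x → f (r + x + (s + x))) c n ≡ ∑ 6 f (r + c + (s + c)) n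
    spread c zero    = refl
    spread c (suc n) = cong (f (r + c + (s + c)) +_)
      (trans (spread (3 + c) n) (cong (λ z → ∑ 6 f z n) (eq′ r s c)))
    double : ∑ 6 f (r + q * 3 + (s + q * 3)) k ≡ ∑ 3 f (r + q * 3 + (s + q * 3)) k
    double = subst (λ n → (∀ x → f (n * 3 + x) ≡ f x) → ∑ 6 f c n ≡ ∑ 3 f c n) (sym k-odd)
      (∑-double 3 f c h) periodic
      where c = r + q * 3 + (s + q * 3)

  infixl 6 _⊞_
  _⊞_ : ∀ {g g′ x y} → ∑ 3 g (q * 3) k ≡ x → ∑ 3 g′ (q * 3) k ≡ y →
    ∑ 3 (λ b → g b + g′ b) (q * 3) k ≡ x + y
  p ⊞ p′ = trans (∑-distrib-+ _ _ (q * 3) k) (cong₂ _+_ p p′)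

  ∑-full-vertices : ∑ 3 (λ b → total (vertexWeight f) (full b)) (q * 3) k ≡ 2
  ∑-full-vertices = begin
    ∑ 3 (λ b → total (vertexWeight f) (full b)) (q * 3) k
      -- As b varies, `3 + b` traces class 0, `2 + b` and `5 + b` class 2, `4 + b` and `1 + b` class
      -- 1.
      ≡⟨ (class-3+ 0 ⊞ class-3+ 0) ⊞ ((refl ⊞ class-3+ 2) ⊞ ((class-3+ 1 ⊞ refl) ⊞ ∑-0 3 (q * 3) k)) ⟩
    class 0 + class 0 + (class 2 + class 2 + (class 1 + class 1 + 0))
      ≡⟨ regroup (class 0) (class 1) (class 2) ⟩
    2 * (class 0 + class 1 + class 2)
      ≡⟨ cong (2 *_) class-partition ⟩
    2 ∎
    where
    open ≡-Reasoning
    regroup : ∀ x y z → x + x + (z + z + (y + y + 0)) ≡ 2 * (x + y + z)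
    regroup = solve-∀

  ∑-full-edges : ∑ 3 (λ b → total (edgeWeight f) (full b)) (q * 3) k ≡ 3
  ∑-full-edges = begin
    ∑ 3 (λ b → total (edgeWeight f) (full b)) (q * 3) k
      -- The outer edges 2b + 6, 2b + 7, 2b + 5 trace the classes 0, 1, 2, raising each multiplicity
      -- from two to three.
      ≡⟨ (class-3+ 0 ⊞ class-3+ 0 ⊞ trans (class-double 3 3) (class-*3+ 2 0))
         ⊞ ((refl ⊞ class-3+ 2 ⊞ trans (class-double 2 5) (class-*3+ 2 1))
         ⊞ ((class-3+ 1 ⊞ refl ⊞ trans (class-double 4 1) (class-3+ 2)) ⊞ ∑-0 3 (q * 3) k)) ⟩
    class 0 + class 0 + class 0 + (class 2 + class 2 + class 1 + (class 1 + class 1 + class 2 + 0))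
      ≡⟨ regroup (class 0) (class 1) (class 2) ⟩
    3 * (class 0 + class 1 + class 2)
      ≡⟨ cong (3 *_) class-partition ⟩
    3 ∎
    where
    open ≡-Reasoning
    regroup : ∀ x y z → x + x + x + (z + z + y + (y + y + z + 0)) ≡ 3 * (x + y + z)
    regroup = solve-∀

  -- The lost labels fill the classes 1 and 2, leaving class 0. It is written `class 3` to match the
  -- doubled labels 2b + 6 in `∑-lostEdges` and the label 0 of the centre in `X≤1`.
  ∑-lostVertices : class 3 + ∑ 3 (lostVertices f) (q * 3) k ≡ 1
  ∑-lostVertices = begin
    class 3 + ∑ 3 (lostVertices f) (q * 3) k  ≡⟨ cong₂ _+_ (class-3+ 0) (class-3+ 2 ⊞ refl) ⟩
    class 0 + (class 2 + class 1)             ≡⟨ regroup (class 0) (class 1) (class 2) ⟩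
    class 0 + class 1 + class 2               ≡⟨ class-partition ⟩
    1                                         ∎
    where
    open ≡-Reasoning
    regroup : ∀ x y z → x + (z + y) ≡ x + y + z
    regroup = solve-∀

  ∑-lostEdges : ∑ 3 (lostEdges f) (q * 3) k ≡ 1
  ∑-lostEdges = trans (trans (class-double 3 3) (class-3+ 3) ⊞ refl) ∑-lostVertices

-- Balanced lists of triangles.

shortened core₁ : ℕ → List (ℕ × ℕ)
shortened b = (3 + b , 3 + b) ∷ (4 + b , 1 + b) ∷ []
core₁     b = (4 + b , 2 + b) ∷ (5 + b , 1 + b) ∷ []

Between : ℕ → ℕ → Set
Between l x = l ≤ x × x ≤ suc l

-- In its uses `suc l` is the constant count of the full blocks, and `d` counts what a layout lacks.
between-deficit : ∀ {l} x d → x + d ≡ suc l → d ≤ 1 → Between l x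
between-deficit {l} x d eq d≤1 =
  ℕ.+-cancelʳ-≤ 1 l x (ℕ.≤-trans (ℕ.≤-reflexive (trans (+-comm l 1) (sym eq))) (ℕ.+-monoʳ-≤ x d≤1)) ,
  ℕ.≤-trans (ℕ.m≤m+n x d) (ℕ.≤-reflexive eq)

close : ∀ {l x y} → l ≤ x → y ≤ suc l → y ∸ x ≤ 1
close {x = x} {y} l≤x y≤ = ℕ.m≤n+o⇒m∸n≤o y x
  (ℕ.≤-trans y≤ (ℕ.≤-trans (s≤s l≤x) (ℕ.≤-reflexive (+-comm 1 x))))

∣-∣≤1 : ∀ {l x y} → Between l x → Between l y → ∣ x - y ∣ ≤ 1
∣-∣≤1 {l} {x} {y} (l≤x , x≤) (l≤y , y≤) with ℕ.≤-total x y
... | inj₁ x≤y = ℕ.≤-trans (ℕ.≤-reflexive (ℕ.m≤n⇒∣m-n∣≡n∸m x≤y)) (close l≤x y≤)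
... | inj₂ y≤x = ℕ.≤-trans (ℕ.≤-reflexive (ℕ.m≤n⇒∣n-m∣≡n∸m y≤x)) (close l≤y x≤)

-- The summand f 0 is the centre.
Balanced : ℕ → List (ℕ × ℕ) → ℕ → Set
Balanced k L l = ∀ f → ResidueCount k f →
  Between l (f 0 + total (vertexWeight f) L) × Between 2 (total (edgeWeight f) L)

balanced-0 : ∀ k h → k ≡ suc (h + h) → Balanced k (blocks full 0 k) 2
balanced-0 zero      h ()
balanced-0 k@(suc _) h k-odd f F =
  -- The outer vertices use every label twice and the centre adds one more 0, so here the level is
  -- 2.
  ( ℕ.≤-trans (ℕ.≤-reflexive (sym v)) (ℕ.m≤n+m _ (f 0))
  , ℕ.+-mono-≤ f0≤1 (ℕ.≤-reflexive v)) ,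
  between-deficit _ 0 (trans (+-identityʳ _) e) z≤n
  where
  open Classes {k = k} {f = f} h k-odd F 0
  open ResidueCount F
  f0≤1 : f 0 ≤ 1
  -- `k` is a successor, so `unit` unfolds to a sum beginning with `f 0`.
  f0≤1 = ℕ.≤-trans (ℕ.m≤m+n _ _) (ℕ.≤-reflexive unit)
  v : total (vertexWeight f) (blocks full 0 k) ≡ 2
  v = trans (total-blocks (vertexWeight f) full 0 k) ∑-full-vertices
  e : total (edgeWeight f) (blocks full 0 k) ≡ 3
  e = trans (total-blocks (edgeWeight f) full 0 k) ∑-full-edges

-- Comparison of the other blocks with the full one.

2+5≡3+4 : ∀ b → 2 + b + (5 + b) ≡ 3 + b + (4 + b)
2+5≡3+4 = solve-∀

4+1≡3+2 : ∀ b → 4 + b + (1 + b) ≡ 3 + b + (2 + b)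
4+1≡3+2 = solve-∀

module _ {f : ℕ → ℕ} (b : ℕ) (periodic : ∀ x → f (3 + b + x) ≡ f x) where

  -- As 3 + b ≡ 0, the edge labels 2b + 6, 2b + 7, 2b + 5 of full b are 0, 1, -1.
  fold-3+3 : f (3 + b + (3 + b)) ≡ f (3 + b)
  fold-3+3 = periodic (3 + b)

  fold-4+2 : f (4 + b + (2 + b)) ≡ f (3 + b)
  fold-4+2 = trans (cong f (eq b)) (periodic (3 + b))
    where
    eq : ∀ b → 4 + b + (2 + b) ≡ 3 + b + (3 + b)
    eq = solve-∀

  fold-5+1 : f (5 + b + (1 + b)) ≡ f (3 + b)
  fold-5+1 = trans (cong f (eq b)) (periodic (3 + b))
    where
    eq : ∀ b → 5 + b + (1 + b) ≡ 3 + b + (3 + b)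
    eq = solve-∀

  fold-2+5 : f (2 + b + (5 + b)) ≡ f (4 + b)
  fold-2+5 = trans (cong f (2+5≡3+4 b)) (periodic (4 + b))

  fold-4+1 : f (4 + b + (1 + b)) ≡ f (2 + b)
  fold-4+1 = trans (cong f (4+1≡3+2 b)) (periodic (2 + b))

  f-0 : f 0 ≡ f (3 + b)
  f-0 = trans (sym (periodic 0)) (cong f (+-identityʳ (3 + b)))

  -- The centre stands in for one of the two outer labels 0 of the full block; 1, -1, 2, -2 are all
  -- kept.
  core₁-vertices : f 0 + total (vertexWeight f) (core₁ b) + f (3 + b) ≡ total (vertexWeight f) (full b)
  core₁-vertices rewrite f-0 = regroup (f (1 + b)) (f (2 + b)) (f (3 + b)) (f (4 + b)) (f (5 + b))
    where
    regroup : ∀ x₁ x₂ x₃ x₄ x₅ → x₃ + (x₄ + x₂ + (x₅ + x₁ + 0)) + x₃ ≡ x₃ + x₃ + (x₂ + x₅ + (x₄ + x₁ + 0))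
    regroup = solve-∀

  -- Both outer edges of `core₁` have label 0, whereas the full block has 0 three times and 1, -1
  -- twice each.
  core₁-edges : total (edgeWeight f) (core₁ b) + (f (2 + b) + f (3 + b) + f (4 + b))
    ≡ total (edgeWeight f) (full b)
  core₁-edges rewrite fold-3+3 | fold-4+2 | fold-5+1 | fold-2+5 | fold-4+1 =
    regroup (f (1 + b)) (f (2 + b)) (f (3 + b)) (f (4 + b)) (f (5 + b))
    where
    regroup : ∀ x₁ x₂ x₃ x₄ x₅ → x₄ + x₂ + x₃ + (x₅ + x₁ + x₃ + 0) + (x₂ + x₃ + x₄)
      ≡ x₃ + x₃ + x₃ + (x₂ + x₅ + x₄ + (x₄ + x₁ + x₂ + 0))
    regroup = solve-∀

  -- Compared with a reduced block, `core` lacks two labels 0 and has an extra 1 and an extra -1, so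
  -- corrections appear on both sides.
  core-vertices : total (vertexWeight f) (core b) + lostVertices f b + (f (3 + b) + f (3 + b))
    ≡ total (vertexWeight f) (full b) + (f (4 + b) + f (2 + b))
  core-vertices = regroup (f (1 + b)) (f (2 + b)) (f (3 + b)) (f (4 + b)) (f (5 + b))
    where
    regroup : ∀ x₁ x₂ x₃ x₄ x₅ → x₄ + x₂ + (x₄ + x₂ + 0) + (x₅ + x₁) + (x₃ + x₃)
      ≡ x₃ + x₃ + (x₂ + x₅ + (x₄ + x₁ + 0)) + (x₄ + x₂)
    regroup = solve-∀

  -- On edges `core` agrees with a reduced block: each of 0, 1, -1 occurs twice.
  core-edges : total (edgeWeight f) (core b) + lostEdges f b
    ≡ total (edgeWeight f) (full b)
  core-edges rewrite fold-3+3 | fold-4+2 | fold-2+5 | fold-4+1 =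
    regroup (f (1 + b)) (f (2 + b)) (f (3 + b)) (f (4 + b)) (f (5 + b))
    where
    regroup : ∀ x₁ x₂ x₃ x₄ x₅ → x₄ + x₂ + x₃ + (x₄ + x₂ + x₃ + 0) + (x₃ + (x₅ + x₁))
      ≡ x₃ + x₃ + x₃ + (x₂ + x₅ + x₄ + (x₄ + x₁ + x₂ + 0))
    regroup = solve-∀

reduced-vertices : ∀ f b → total (vertexWeight f) (reduced b) + lostVertices f b
  ≡ total (vertexWeight f) (full b)
reduced-vertices f b = regroup (f (1 + b)) (f (2 + b)) (f (3 + b)) (f (4 + b)) (f (5 + b))
  where
  regroup : ∀ x₁ x₂ x₃ x₄ x₅ → x₃ + x₄ + (x₃ + x₂ + 0) + (x₅ + x₁) ≡ x₃ + x₃ + (x₂ + x₅ + (x₄ + x₁ + 0))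
  regroup = solve-∀

-- The outer edges 2b + 7 and 2b + 5 survive as (3 + b) + (4 + b) and (3 + b) + (2 + b); of the
-- three only 2b + 6 disappears.
reduced-edges : ∀ f b → total (edgeWeight f) (reduced b) + lostEdges f b
  ≡ total (edgeWeight f) (full b)
reduced-edges f b rewrite 2+5≡3+4 b | 4+1≡3+2 b =
  regroup (f (1 + b)) (f (2 + b)) (f (3 + b)) (f (4 + b)) (f (5 + b))
    (f (3 + b + (2 + b))) (f (3 + b + (3 + b))) (f (3 + b + (4 + b)))
  where
  regroup : ∀ x₁ x₂ x₃ x₄ x₅ s₅ s₆ s₇ → x₃ + x₄ + s₇ + (x₃ + x₂ + s₅ + 0) + (s₆ + (x₅ + x₁))
    ≡ x₃ + x₃ + s₆ + (x₂ + x₅ + s₇ + (x₄ + x₁ + s₅ + 0))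
  regroup = solve-∀

shortened-vertices : ∀ f b → total (vertexWeight f) (shortened b) + (f (2 + b) + f (5 + b))
  ≡ total (vertexWeight f) (full b)
shortened-vertices f b = regroup (f (3 + b) + f (3 + b)) (f (2 + b) + f (5 + b)) _
  where
  regroup : ∀ x y z → x + z + y ≡ x + (y + z)
  regroup = solve-∀

shortened-edges : ∀ f b → total (edgeWeight f) (shortened b) + (f (2 + b) + f (5 + b) + f (2 + b + (5 + b)))
  ≡ total (edgeWeight f) (full b)
shortened-edges f b = regroup (f (3 + b) + f (3 + b) + f (3 + b + (3 + b)))
  (f (2 + b) + f (5 + b) + f (2 + b + (5 + b))) _
  where
  regroup : ∀ x y z → x + z + y ≡ x + (y + z)
  regroup = solve-∀

-- The layouts and their balance.

layout₁ layout₂ : ℕ → List (ℕ × ℕ)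
layout₁ v = core₁ c ++ blocks full (3 + c) v
  -- Chosen so that `3 + c` computes to the modulus; likewise `3 + c` in `layout₂` and `6 + c` in
  -- `layout₃`.
  where c = v * 3
layout₂ v = core₁ c ++ shortened (3 + c) ++ blocks full (6 + c) (suc v)
  where c = (2 + v) * 3

-- The core has reduced neighbours on both sides; these three blocks and `u` more lose one triangle
-- each, and `v` blocks stay full.
layout₃ : ℕ → ℕ → List (ℕ × ℕ)
layout₃ u v = reduced c ++ core (3 + c) ++ reduced (6 + c) ++
  blocks reduced (9 + c) u ++ blocks full (u * 3 + (9 + c)) v
  where c = (1 + (u + v)) * 3

balanced-1 : ∀ v h → suc v ≡ suc (h + h) → Balanced (suc v) (layout₁ v) 1
balanced-1 v h k-odd f F =
  between-deficit _ (f (3 + c)) vertices-eq (ℕ.≤-trans vertices-bound edges-bound) ,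
  between-deficit _ _ edges-eq edges-bound
  where
  c = v * 3
  open Classes {k = suc v} {f = f} h k-odd F v
  open ResidueCount F
  open ≡-Reasoning
  R : (ℕ × ℕ → ℕ) → ℕ
  R w = ∑ 3 (λ b → total w (full b)) (3 + c) v
  vertices-eq : f 0 + total (vertexWeight f) (core₁ c ++ blocks full (3 + c) v) + f (3 + c) ≡ 2
  vertices-eq = begin
    f 0 + total (vertexWeight f) (core₁ c ++ blocks full (3 + c) v) + f (3 + c)
      ≡⟨ cong (λ z → f 0 + z + f (3 + c)) (total-++-blocks (vertexWeight f) (core₁ c) full (3 + c) v) ⟩
    f 0 + (total (vertexWeight f) (core₁ c) + R (vertexWeight f)) + f (3 + c)
      ≡⟨ regroup (f 0) (total (vertexWeight f) (core₁ c)) (R (vertexWeight f)) (f (3 + c)) ⟩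
    f 0 + total (vertexWeight f) (core₁ c) + f (3 + c) + R (vertexWeight f)
      ≡⟨ cong (_+ R (vertexWeight f)) (core₁-vertices c periodic) ⟩
    ∑ 3 (λ b → total (vertexWeight f) (full b)) c (suc v)
      ≡⟨ ∑-full-vertices ⟩
    2 ∎
    where
    regroup : ∀ x y z w → x + (y + z) + w ≡ x + y + w + z
    regroup = solve-∀
  edges-eq : total (edgeWeight f) (core₁ c ++ blocks full (3 + c) v) + (f (2 + c) + f (3 + c) + f (4 + c))
    ≡ 3
  edges-eq = begin
    total (edgeWeight f) (core₁ c ++ blocks full (3 + c) v) + d
      ≡⟨ cong (_+ d) (total-++-blocks (edgeWeight f) (core₁ c) full (3 + c) v) ⟩
    total (edgeWeight f) (core₁ c) + R (edgeWeight f) + d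
      ≡⟨ regroup (total (edgeWeight f) (core₁ c)) (R (edgeWeight f)) d ⟩
    total (edgeWeight f) (core₁ c) + d + R (edgeWeight f)
      ≡⟨ cong (_+ R (edgeWeight f)) (core₁-edges c periodic) ⟩
    ∑ 3 (λ b → total (edgeWeight f) (full b)) c (suc v)
      ≡⟨ ∑-full-edges ⟩
    3 ∎
    where
    d = f (2 + c) + f (3 + c) + f (4 + c)
    regroup : ∀ x y z → x + y + z ≡ x + z + y
    regroup = solve-∀
  edges-bound : f (2 + c) + f (3 + c) + f (4 + c) ≤ 1
  -- The lost edge labels -1, 0, 1 open the full window of residues from `2 + c`, hence are
  -- distinct.
  edges-bound = ℕ.m+n≤o⇒m≤o _ {∑ 1 f (5 + c) (v * 3)} (ℕ.≤-reflexive
    (trans (regroup (f (2 + c)) (f (3 + c)) (f (4 + c)) _) (unit-from (2 + c))))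
    where
    regroup : ∀ x y z w → x + y + z + w ≡ x + (y + (z + w))
    regroup = solve-∀
  vertices-bound : f (3 + c) ≤ f (2 + c) + f (3 + c) + f (4 + c)
  vertices-bound = ℕ.≤-trans (ℕ.m≤n+m _ (f (2 + c))) (ℕ.m≤m+n _ (f (4 + c)))

balanced-2 : ∀ v h → 3 + v ≡ suc (h + h) → Balanced (3 + v) (layout₂ v) 1
balanced-2 v h k-odd f F =
  between-deficit _ dᵥ vertices-eq
    (ℕ.m+n≤o⇒m≤o dᵥ (ℕ.≤-trans (ℕ.≤-reflexive (sym edges-deficit)) edges-bound)) ,
  between-deficit _ dₑ edges-eq edges-bound
  where
  c = (2 + v) * 3
  open Classes {k = 3 + v} {f = f} h k-odd F (2 + v)
  open ResidueCount F
  open ≡-Reasoning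
  R : (ℕ × ℕ → ℕ) → ℕ
  R w = ∑ 3 (λ b → total w (full b)) (6 + c) (suc v)
  L = core₁ c ++ shortened (3 + c) ++ blocks full (6 + c) (suc v)
  total-L : ∀ w → total w L ≡ total w (core₁ c) + (total w (shortened (3 + c)) + R w)
  total-L w = trans (total-++ w (core₁ c) (shortened (3 + c) ++ blocks full (6 + c) (suc v)))
    (cong (total w (core₁ c) +_) (total-++-blocks w (shortened (3 + c)) full (6 + c) (suc v)))
  dᵥ dₑ : ℕ
  dᵥ = f (3 + c) + (f (5 + c) + f (8 + c))
  dₑ = (f (2 + c) + f (3 + c) + f (4 + c)) + (f (5 + c) + f (8 + c) + f (5 + c + (8 + c)))

  edges-deficit : dₑ ≡ dᵥ + (f (2 + c) + f (4 + c) + f (5 + c + (8 + c)))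
  edges-deficit = regroup (f (2 + c)) (f (3 + c)) (f (4 + c)) (f (5 + c)) (f (8 + c)) _
    where
    regroup : ∀ x₂ x₃ x₄ x₅ x₈ y → x₂ + x₃ + x₄ + (x₅ + x₈ + y) ≡ x₃ + (x₅ + x₈) + (x₂ + x₄ + y)
    regroup = solve-∀

  vertices-eq : f 0 + total (vertexWeight f) L + dᵥ ≡ 2
  vertices-eq = begin
    f 0 + total V L + dᵥ
      ≡⟨ cong (λ z → f 0 + z + dᵥ) (total-L V) ⟩
    f 0 + (total V (core₁ c) + (total V (shortened (3 + c)) + R V)) + (f (3 + c) + s)
      ≡⟨ regroup (f 0) (total V (core₁ c)) (total V (shortened (3 + c))) (R V) (f (3 + c)) s ⟩
    f 0 + total V (core₁ c) + f (3 + c) + (total V (shortened (3 + c)) + s + R V)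
      ≡⟨ cong₂ _+_ (core₁-vertices c periodic)
           (cong (_+ R V) (shortened-vertices f (3 + c))) ⟩
    ∑ 3 (λ b → total V (full b)) c (3 + v)
      ≡⟨ ∑-full-vertices ⟩
    2 ∎
    where
    V = vertexWeight f
    s = f (5 + c) + f (8 + c)
    regroup : ∀ x y z w d e → x + (y + (z + w)) + (d + e) ≡ x + y + d + (z + e + w)
    regroup = solve-∀

  edges-eq : total (edgeWeight f) L + dₑ ≡ 3
  edges-eq = begin
    total E L + dₑ
      ≡⟨ cong (_+ dₑ) (total-L E) ⟩
    total E (core₁ c) + (total E (shortened (3 + c)) + R E) + (d + s)
      ≡⟨ regroup (total E (core₁ c)) (total E (shortened (3 + c))) (R E) d s ⟩
    total E (core₁ c) + d + (total E (shortened (3 + c)) + s + R E)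
      ≡⟨ cong₂ _+_ (core₁-edges c periodic)
           (cong (_+ R E) (shortened-edges f (3 + c))) ⟩
    ∑ 3 (λ b → total E (full b)) c (3 + v)
      ≡⟨ ∑-full-edges ⟩
    3 ∎
    where
    E = edgeWeight f
    d = f (2 + c) + f (3 + c) + f (4 + c)
    s = f (5 + c) + f (8 + c) + f (5 + c + (8 + c))
    regroup : ∀ y z w d e → y + (z + w) + (d + e) ≡ y + d + (z + e + w)
    regroup = solve-∀

  -- The lost edge labels -1, 0, 1, 2, 5, 7 lie among the nine consecutive residues from -1 to 7,
  -- which are distinct as the modulus is at least 9. The rest of the window is `r`.
  edges-bound : dₑ ≤ 1
  edges-bound = ℕ.m+n≤o⇒m≤o dₑ {r} (ℕ.≤-reflexive
    (trans (cong (λ z → f (2 + c) + f (3 + c) + f (4 + c) + (f (5 + c) + f (8 + c) + z) + r) wrap)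
    (trans (regroup (f (2 + c)) (f (3 + c)) (f (4 + c)) (f (5 + c)) (f (6 + c))
                    (f (7 + c)) (f (8 + c)) (f (9 + c)) (f (10 + c)) (∑ 1 f (11 + c) (v * 3)))
      (unit-from (2 + c)))))
    where
    r : ℕ
    r = f (6 + c) + f (7 + c) + f (9 + c) + ∑ 1 f (11 + c) (v * 3)
    eq : ∀ c → 5 + c + (8 + c) ≡ 3 + c + (10 + c)
    eq = solve-∀
    wrap : f (5 + c + (8 + c)) ≡ f (10 + c)
    wrap = trans (cong f (eq c)) (periodic (10 + c))
    regroup : ∀ x₂ x₃ x₄ x₅ x₆ x₇ x₈ x₉ x₁₀ r →
      x₂ + x₃ + x₄ + (x₅ + x₈ + x₁₀) + (x₆ + x₇ + x₉ + r)
      ≡ x₂ + (x₃ + (x₄ + (x₅ + (x₆ + (x₇ + (x₈ + (x₉ + (x₁₀ + r))))))))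
    regroup = solve-∀

balanced-3+ : ∀ u v h → 3 + (u + v) ≡ suc (h + h) → Balanced (3 + (u + v)) (layout₃ u v) 1
balanced-3+ u v h k-odd f F = (vertices-lower , vertices-upper) , between-deficit _ _ edges-eq edges-bound
  where
  c = (1 + (u + v)) * 3
  k = 3 + (u + v)
  open Classes {k = k} {f = f} h k-odd F (1 + (u + v))
  open ResidueCount F
  V = vertexWeight f
  E = edgeWeight f
  L₄ = blocks reduced (9 + c) u ++ blocks full (u * 3 + (9 + c)) v
  L₃ = reduced (6 + c) ++ L₄
  L₂ = core (3 + c) ++ L₃
  L = reduced c ++ L₂

  module _ (w : ℕ × ℕ → ℕ) (d : ℕ → ℕ)
           (reduced-eq : ∀ b → total w (reduced b) + d b ≡ total w (full b)) where

    -- Stated for both weights at once. The core is exchanged for a full block by adding to both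
    -- sides, as their difference has no fixed sign on vertices.
    total-L : total w L + ∑ 3 d c (3 + u) + total w (full (3 + c))
      ≡ ∑ 3 (λ b → total w (full b)) c k + (total w (core (3 + c)) + d (3 + c))
    total-L = begin
      total w L + ∑ 3 d c (3 + u) + F₂
        ≡⟨ cong (λ z → z + ∑ 3 d c (3 + u) + F₂) split ⟩
      R₁ + (C + (R₃ + (Rs + Fs))) + (d c + (d (3 + c) + (d (6 + c) + Ds))) + F₂
        ≡⟨ regroup R₁ C R₃ Rs Fs (d c) (d (3 + c)) (d (6 + c)) Ds F₂ ⟩
      R₁ + d c + (F₂ + (R₃ + d (6 + c) + (Rs + Ds + Fs))) + (C + d (3 + c))
        ≡⟨ cong (_+ (C + d (3 + c))) (cong₂ _+_ (reduced-eq c)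
             (cong (F₂ +_) (cong₂ _+_ (reduced-eq (6 + c)) tail))) ⟩
      ∑ 3 (λ b → total w (full b)) c k + (C + d (3 + c)) ∎
      where
      open ≡-Reasoning
      R₁ = total w (reduced c)
      C  = total w (core (3 + c))
      F₂ = total w (full (3 + c))
      R₃ = total w (reduced (6 + c))
      Rs = ∑ 3 (λ b → total w (reduced b)) (9 + c) u
      Ds = ∑ 3 d (9 + c) u
      Fs = ∑ 3 (λ b → total w (full b)) (u * 3 + (9 + c)) v
      split : total w L ≡ R₁ + (C + (R₃ + (Rs + Fs)))
      split = trans (total-++ w (reduced c) L₂) (cong (R₁ +_)
        (trans (total-++ w (core (3 + c)) L₃) (cong (C +_)
        (trans (total-++ w (reduced (6 + c)) L₄) (cong (R₃ +_)
        (trans (total-++-blocks w (blocks reduced (9 + c) u) full (u * 3 + (9 + c)) v)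
          (cong (_+ Fs) (total-blocks w reduced (9 + c) u))))))))
      tail : Rs + Ds + Fs ≡ ∑ 3 (λ b → total w (full b)) (9 + c) (u + v)
      tail = trans (cong (_+ Fs) (trans (sym (∑-distrib-+ _ d (9 + c) u)) (∑-cong reduced-eq (9 + c) u)))
        (sym (∑-split 3 _ (9 + c) u v))
      regroup : ∀ r₁ x r₃ rs fs d₁ d₂ d₃ ds f₂ →
        r₁ + (x + (r₃ + (rs + fs))) + (d₁ + (d₂ + (d₃ + ds))) + f₂
        ≡ r₁ + d₁ + (f₂ + (r₃ + d₃ + (rs + ds + fs))) + (x + d₂)
      regroup = solve-∀

  edges-eq : total E L + ∑ 3 (lostEdges f) c (3 + u) ≡ 3
  edges-eq = ℕ.+-cancelʳ-≡ (total E (full (3 + c))) _ _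
    (trans (total-L E (lostEdges f) (reduced-edges f))
      (cong₂ _+_ ∑-full-edges (core-edges (3 + c) periodic)))

  edges-bound : ∑ 3 (lostEdges f) c (3 + u) ≤ 1
  edges-bound = ℕ.≤-trans (∑-prefix 3 (lostEdges f) c (3 + u) v) (ℕ.≤-reflexive ∑-lostEdges)

  -- X counts the vertex labels lost, Y the labels 1 and -1 that core regains.
  X Y : ℕ
  X = f (6 + c) + ∑ 3 (lostVertices f) c (3 + u)
  Y = f (7 + c) + f (5 + c)

  -- With Y ≤ X ≤ 1 the count 2 - X + Y is 1 or 2.
  vertices-eq : f 0 + total V L + X ≡ 2 + Y
  vertices-eq = ℕ.+-cancelʳ-≡ (total V (full (3 + c))) _ _ (begin
    f 0 + total V L + X + F₂
      ≡⟨ cong (λ z → z + total V L + X + F₂) (f-0 (3 + c) periodic) ⟩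
    x + total V L + (x + ∑ 3 (lostVertices f) c (3 + u)) + F₂
      ≡⟨ regroup x (total V L) (∑ 3 (lostVertices f) c (3 + u)) F₂ ⟩
    total V L + ∑ 3 (lostVertices f) c (3 + u) + F₂ + (x + x)
      ≡⟨ cong (_+ (x + x)) (total-L V (lostVertices f) (reduced-vertices f)) ⟩
    ∑ 3 (λ b → total V (full b)) c k + (total V (core (3 + c)) + lostVertices f (3 + c)) + (x + x)
      ≡⟨ +-assoc (∑ 3 (λ b → total V (full b)) c k)
           (total V (core (3 + c)) + lostVertices f (3 + c)) (x + x) ⟩
    ∑ 3 (λ b → total V (full b)) c k + (total V (core (3 + c)) + lostVertices f (3 + c) + (x + x))
      ≡⟨ cong₂ _+_ ∑-full-vertices (core-vertices (3 + c) periodic) ⟩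
    2 + (F₂ + Y)
      ≡⟨ cong (2 +_) (+-comm F₂ Y) ⟩
    2 + Y + F₂ ∎)
    where
    open ≡-Reasoning
    x  = f (6 + c)
    F₂ = total V (full (3 + c))
    regroup : ∀ x t s g → x + t + (x + s) + g ≡ t + s + g + (x + x)
    regroup = solve-∀

  -- The label 0 is a multiple of 3 and the labels in `lostVertices` are not, so no residue is lost
  -- twice.
  X≤1 : X ≤ 1
  X≤1 = ℕ.≤-trans (ℕ.+-mono-≤ centre (∑-prefix 3 (lostVertices f) c (3 + u) v))
    (ℕ.≤-reflexive ∑-lostVertices)
    where
    centre : f (6 + c) ≤ class 3
    centre = ℕ.≤-trans (ℕ.m≤m+n _ _) (ℕ.m≤n+m _ (f (3 + c)))

  -- The regained -1 and 1 are the labels `5 + c` and `7 + c` lost by the blocks at `c` and `6 + c`;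
  -- this is why both neighbours of the core are reduced.
  Y≤X : Y ≤ X
  Y≤X = ℕ.m+n≤o⇒m≤o Y
    {f (6 + c) + f (1 + c) + lostVertices f (3 + c) + f (11 + c) + ∑ 3 (lostVertices f) (9 + c) u}
    (ℕ.≤-reflexive (regroup (f (7 + c)) (f (5 + c)) (f (6 + c)) (f (1 + c))
      (lostVertices f (3 + c)) (f (11 + c)) (∑ 3 (lostVertices f) (9 + c) u)))
    where
    regroup : ∀ x₇ x₅ x₆ x₁ d₃ x₁₁ s → x₇ + x₅ + (x₆ + x₁ + d₃ + x₁₁ + s)
      ≡ x₆ + (x₅ + x₁ + (d₃ + (x₁₁ + x₇ + s)))
    regroup = solve-∀

  vertices-upper : f 0 + total V L ≤ 2
  vertices-upper = ℕ.+-cancelʳ-≤ X _ _ (ℕ.≤-trans (ℕ.≤-reflexive vertices-eq) (ℕ.+-monoʳ-≤ 2 Y≤X))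

  vertices-lower : 1 ≤ f 0 + total V L
  vertices-lower = ℕ.+-cancelʳ-≤ 1 1 _
    (ℕ.≤-trans (ℕ.≤-trans (ℕ.m≤m+n 2 Y) (ℕ.≤-reflexive (sym vertices-eq)))
      (ℕ.+-monoʳ-≤ (f 0 + total V L) X≤1))

-- Indicators of residues.

∑-zero : ∀ g c n → (∀ x → c ≤ x → x < n + c → g x ≡ 0) → ∑ 1 g c n ≡ 0
∑-zero g c zero    g≡0 = refl
∑-zero g c (suc n) g≡0 = cong₂ _+_ (g≡0 c ℕ.≤-refl (s≤s (ℕ.m≤n+m c n)))
  (∑-zero g (suc c) n λ x c<x x< → g≡0 x (ℕ.<⇒≤ c<x) (subst (x <_) (+-suc n c) x<))

∑-single : ∀ g p c n → c ≤ p → p < n + c → g p ≡ 1 →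
  (∀ x → x < n + c → x ≢ p → g x ≡ 0) → ∑ 1 g c n ≡ 1
∑-single g p c zero    c≤p p< gp≡1 g≡0 = ⊥-elim (ℕ.<⇒≱ p< c≤p)
∑-single g p c (suc n) c≤p p< gp≡1 g≡0 with c ℕ.≟ p
... | yes refl = cong₂ _+_ gp≡1
  (∑-zero g (suc c) n λ x c<x x< → g≡0 x (subst (x <_) (+-suc n c) x<) (≢-sym (ℕ.<⇒≢ c<x)))
... | no c≢p = cong₂ _+_ (g≡0 c (s≤s (ℕ.m≤n+m c n)) c≢p)
  (∑-single g p (suc c) n (ℕ.≤∧≢⇒< c≤p c≢p) (subst (p <_) (sym (+-suc n c)) p<) gp≡1
    λ x x< → g≡0 x (subst (x <_) (+-suc n c) x<))

indicator-yes : ∀ {p} {P : Set p} (P? : Dec P) → P → indicator P? ≡ 1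
indicator-yes (yes _) p = refl
indicator-yes (no ¬p) p = ⊥-elim (¬p p)

indicator-no : ∀ {p} {P : Set p} (P? : Dec P) → ¬ P → indicator P? ≡ 0
indicator-no (yes p) ¬p = ⊥-elim (¬p p)
indicator-no (no _)  ¬p = refl

-- Below the modulus reduction changes nothing, so only `toℕ a` hits `a`.
hits-residueCount : ∀ k .{{_ : NonZero (k * 3)}} (a : Fin (k * 3)) → ResidueCount k (hits (k * 3) a)
hits-residueCount k a = record
  { periodic = λ x → cong (λ z → indicator (z Fin.≟ a))
      (mod-cong m (trans (cong (_% m) (+-comm m x)) ([m+n]%n≡m%n x m)))
  ; unit = ∑-single (hits m a) (toℕ a) 0 m z≤n (below (Fin.toℕ<n a))
      (indicator-yes (toℕ a mod m Fin.≟ a) (mod-toℕ m a))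
      (λ x x< x≢a → indicator-no (x mod m Fin.≟ a) λ { refl →
        x≢a (sym (trans (toℕ-mod m x) (m<n⇒m%n≡m (subst (x <_) (+-identityʳ m) x<)))) })
  }
  where
  m = k * 3
  below : ∀ {x} → x < m → x < m + 0
  below {x} = subst (x <_) (sym (+-identityʳ m))

-- Choice of the layout and conclusion.

length-blocks : ∀ B s → (∀ b → length (B b) ≡ s) → ∀ b n → length (blocks B b n) ≡ n * s
length-blocks B s eq b zero    = refl
length-blocks B s eq b (suc n) = trans (length-++ (B b)) (cong₂ _+_ (eq b) (length-blocks B s eq (3 + b) n))

balanced-layout : ∀ k h t → k ≡ suc (h + h) → t ≤ k →
  ∃[ L ] ∃[ l ] (length L + t ≡ k * 3 × Balanced k L l)
balanced-layout k h 0 k-odd _ = blocks full 0 k , 2 ,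
  trans (+-identityʳ _) (length-blocks full 3 (λ _ → refl) 0 k) ,
  balanced-0 k h k-odd
balanced-layout (suc v) h 1 k-odd _ = layout₁ v , 1 ,
  trans (+-comm _ 1) (cong (3 +_) (length-blocks full 3 (λ _ → refl) (3 + v * 3) v)) ,
  balanced-1 v h k-odd
-- `layout₂` needs three blocks: `k = 1` violates `t ≤ k`, and `k = 2` is even.
balanced-layout 1 h 2 _ (s≤s ())
balanced-layout 2 zero    2 () _
balanced-layout 2 (suc h) 2 k-odd _ with () ← trans k-odd (cong (2 +_) (+-suc h h))
balanced-layout (suc (suc (suc v))) h 2 k-odd _ = layout₂ v , 1 ,
  trans (+-comm _ 2) (cong (9 +_) (length-blocks full 3 (λ _ → refl) (9 + (2 + v) * 3) v)) ,
  balanced-2 v h k-odd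
balanced-layout k h (suc (suc (suc u))) k-odd t≤k with v , refl ← ℕ.m≤n⇒∃[o]m+o≡n t≤k =
  layout₃ u v , 1 , length-eq v , balanced-3+ u v h k-odd
  where
  regroup : ∀ u v → 6 + (u * 2 + v * 3) + (3 + u) ≡ (3 + (u + v)) * 3
  regroup = solve-∀
  length-eq : ∀ v → length (layout₃ u v) + (3 + u) ≡ (3 + (u + v)) * 3
  -- The 6 counts the triangles of the three blocks around 0, two in each.
  length-eq v = trans (cong (λ z → 6 + z + (3 + u)) (trans (length-++ (blocks reduced b u))
    (cong₂ _+_ (length-blocks reduced 2 (λ _ → refl) b u)
               (length-blocks full 3 (λ _ → refl) (u * 3 + b) v)))) (regroup u v)
    where b = 9 + (1 + (u + v)) * 3

even-or-odd : ∀ n → (∃[ h ] n ≡ h + h) ⊎ (∃[ h ] n ≡ suc (h + h))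
even-or-odd zero    = inj₁ (0 , refl)
even-or-odd (suc n) with even-or-odd n
... | inj₁ (h , refl) = inj₂ (h , refl)
... | inj₂ (h , refl) = inj₁ (suc h , cong suc (sym (+-suc h h)))

-- The levels in `Balanced` do not depend on the residue counted, so all counts lie between the same
-- two consecutive numbers.
balanced⇒cordial : ∀ k .{{_ : NonZero (k * 3)}} L l → Balanced k L l →
  ℤmod-Cordial (k * 3) (friendship (length L))
balanced⇒cordial k L l bal = labelling m L ,
  (λ a₁ a₂ → ∣-∣≤1 (vertexBounds a₁) (vertexBounds a₂)) ,
  (λ a₁ a₂ → ∣-∣≤1 (edgeBounds a₁) (edgeBounds a₂))
  where
  m = k * 3
  open Cordiality (ℤmod m) Fin._≟_
  vertexBounds : ∀ a → Between l (fV (friendship (length L)) (labelling m L) a)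
  vertexBounds a = subst (Between l) (sym (fV-labelling m L a))
    (proj₁ (bal (hits m a) (hits-residueCount k a)))
  edgeBounds : ∀ a → Between 2 (fE (friendship (length L)) (labelling m L) a)
  edgeBounds a = subst (Between 2) (sym (fE-labelling m L a))
    (proj₂ (bal (hits m a) (hits-residueCount k a)))

-- With m = 3k the quotient 2m/3 is exactly 2k, so at most one triangle per block has to go.
triangles-dropped≤ : ∀ k j → 2 * (k * 3) / 3 ≤ j → k * 3 ∸ j ≤ k
triangles-dropped≤ k j 2m/3≤j =
  ℕ.m≤n+o⇒m∸n≤o (k * 3) j (ℕ.≤-trans (ℕ.≤-reflexive (*3 k)) (ℕ.+-monoˡ-≤ k 2k≤j))
  where
  *3 : ∀ k → k * 3 ≡ k * 2 + k
  *3 = solve-∀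
  regroup : ∀ k → 2 * (k * 3) ≡ k * 2 * 3
  regroup = solve-∀
  2k≤j : k * 2 ≤ j
  2k≤j = subst (_≤ j) (trans (cong (_/ 3) (regroup k)) (m*n/n≡m (k * 2) 3)) 2m/3≤j

theorem12p2 : (m : ℕ) .{{_ : NonZero m}} → ¬ (2 ∣ m) → 3 ∣ m →
    (j : ℕ) → 2 * m / 3 ≤ j → j ≤ m → ℤmod-Cordial m (friendship j)
theorem12p2 m ¬2∣m (divides k refl) j 2m/3≤j j≤m with even-or-odd k
-- An even k would make m even.
... | inj₁ (h , refl) = ⊥-elim (¬2∣m (divides (h * 3) (regroup h)))
  where
  regroup : ∀ h → (h + h) * 3 ≡ h * 3 * 2
  regroup = solve-∀
... | inj₂ (h , k-odd)
  with L , l , length-eq , bal ← balanced-layout k h (k * 3 ∸ j) k-odd (triangles-dropped≤ k j 2m/3≤j) =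
  subst (λ i → ℤmod-Cordial (k * 3) (friendship i)) length≡j (balanced⇒cordial k L l bal)
  where
  length≡j : length L ≡ j
  length≡j = ℕ.+-cancelʳ-≡ (k * 3 ∸ j) _ _ (trans length-eq (sym (ℕ.m+[n∸m]≡n j≤m)))
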